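{- Consider the game ${\rm SCN}(5,2)$. Its P-positions (among all configurations that can arise, i.e. circular arrangements of at most $5$ piles with positive pile sizes) are exactly the following: (1) the terminal configuration $()$; (2) $(a,a,a)$ with $a\ge 1$; (3) $(a,b,a,b)$ with $a,b\ge1$, $a\neq b$; (4) $(M,m,a,b,m)$ with $m\ge 1$, $m<a<M$, $m<b<M$ and $m+M=a+b$; (5) $(m+1,M,m,m,M)$ with $m\ge 1$ even and $M\ge m+2$; (6) $(m+1,M,m,m,M)$ with $m\ge 1$ odd and $M\ge m+3$; (7) $(m+2,m+1,m,m,m+1)$ with $m\ge 1$ odd; (8) $(m+1,m+1,m,m,m+2)$ with $m\ge 1$ odd.
   Context: Shrinking Circular Nim ${\rm SCN}(n,k)$, for positive integers $k\le n$: initially $n$ piles of stones are arranged on a circle. Two players alternate turns. On a turn, a player selects $k$ consecutive (cyclically adjacent) piles among the currently remaining piles and removes any number of stones from each of them, removing at least one stone in total (some of the selected piles may be left untouched). Whenever a pile becomes empty it vanishes and the circle closes up: the remaining piles keep their cyclic order and the neighbours of the vanished pile become adjacent. If at most $k$ piles remain, a move may remove stones from any of the remaining piles (all of them may be selected). The player who removes the last stone wins (a player with no move loses). A configuration is written as the tuple $(x_1,\dots,x_r)$ of the positive pile sizes in cyclic order; tuples that agree up to rotation or reflection denote the same configuration, and $()$ denotes the empty (terminal) configuration. A P-position is a configuration from which the player to move loses under optimal play by the opponent. -}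

module Defs where

open import Data.Nat using (ℕ; zero; suc; _+_; _≤_; _<_)
open import Data.Nat.Divisibility using (_∣_)
open import Data.Fin using (Fin; toℕ)
open import Data.List using (List; []; _∷_; length; lookup; tabulate; reverse; _++_)
open import Data.Product using (Σ; Σ-syntax; ∃; _×_)
open import Data.Sum using (_⊎_)
open import Relation.Binary.PropositionalEquality using (_≡_; _≢_)
open import Relation.Nullary using (¬_)

-- A configuration is the list of (positive) pile sizes in cyclic order.
Config : Set
Config = List ℕ

removeZeros : List ℕ → List ℕ
removeZeros [] = []
removeZeros (zero ∷ xs) = removeZeros xs
removeZeros (suc x ∷ xs) = suc x ∷ removeZeros xs

-- Pile j (of r piles) lies in the window of k = 2 cyclically consecutive
-- piles starting at pile i, namely {i, i+1 mod r}.
-- (For r ≤ 2 such a window covers all piles, matching the rule that then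
--  all piles may be selected.)
InWindow : ∀ {r} → Fin r → Fin r → Set
InWindow {r} i j = toℕ j ≡ toℕ i ⊎ toℕ j ≡ suc (toℕ i) ⊎ (suc (toℕ i) ≡ r × toℕ j ≡ 0)

Move : Config → Config → Set
Move c c' =
  Σ[ i ∈ Fin (length c) ] Σ[ d ∈ (Fin (length c) → ℕ) ]
    ((∀ j → d j ≤ lookup c j)
    × (∀ j → d j ≢ lookup c j → InWindow i j)
    × (Σ[ j ∈ Fin (length c) ] d j < lookup c j)
    × c' ≡ removeZeros (tabulate d))

-- P- and N-positions (the game is finite, so this inductive definition
-- is the usual one: P iff every move leads to an N-position; N iff some
-- move leads to a P-position).
mutual
  data IsP (c : Config) : Set where
    isP : (∀ c' → Move c c' → IsN c') → IsP c

  data IsN (c : Config) : Set where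
    isN : (c' : Config) → Move c c' → IsP c' → IsN c

rot1 : Config → Config
rot1 [] = []
rot1 (x ∷ xs) = xs ++ (x ∷ [])

rot : ℕ → Config → Config
rot zero c = c
rot (suc n) c = rot n (rot1 c)

SameConfig : Config → Config → Set
SameConfig c c' = Σ[ n ∈ ℕ ] (c' ≡ rot n c ⊎ c' ≡ rot n (reverse c))

data Listed : Config → Set where
  f1 : Listed []
  f2 : ∀ a → 1 ≤ a → Listed (a ∷ a ∷ a ∷ [])
  f3 : ∀ a b → 1 ≤ a → 1 ≤ b → a ≢ b → Listed (a ∷ b ∷ a ∷ b ∷ [])
  f4 : ∀ M m a b → 1 ≤ m → m < a → a < M → m < b → b < M → m + M ≡ a + b →
       Listed (M ∷ m ∷ a ∷ b ∷ m ∷ [])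
  f5 : ∀ m M → 1 ≤ m → 2 ∣ m → m + 2 ≤ M →
       Listed (suc m ∷ M ∷ m ∷ m ∷ M ∷ [])
  f6 : ∀ m M → 1 ≤ m → ¬ (2 ∣ m) → m + 3 ≤ M →
       Listed (suc m ∷ M ∷ m ∷ m ∷ M ∷ [])
  f7 : ∀ m → 1 ≤ m → ¬ (2 ∣ m) →
       Listed (m + 2 ∷ m + 1 ∷ m ∷ m ∷ m + 1 ∷ [])
  f8 : ∀ m → 1 ≤ m → ¬ (2 ∣ m) →
       Listed (m + 1 ∷ m + 1 ∷ m ∷ m ∷ m + 2 ∷ [])

{-# OPTIONS --safe #-}

-- "Cold" is a purely arithmetic description of the listed positions up to symmetry.
--
-- No move joins two cold positions: after rotating the selected window to the front, two
-- cold circles of five piles agreeing on three consecutive piles would satisfy one of finitely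
-- many systems of linear inequalities, all of which Fourier–Motzkin elimination refutes.
--
-- Conversely, a circle (x , m , a , b , y) of five piles that is not cold has a move to a cold
-- one, where m is its least pile.  If a , b > m, which a rotation achieves unless m occurs on
-- two adjacent piles, then (a + b ∸ m , m , a , b , m) or (x , m , a , x + m ∸ a , m) is within
-- reach unless x ≤ a.  For x ≤ a and y = m, deleting b leads to (x , m , x , m); for x , y > m,
-- reflection yields a ≤ x as well, and deleting y leads to (x , m , x , m).  If m occurs on two
-- adjacent piles, the circle is (t , p , m , m , q) with, say, p ≤ q, and lowering q and t
-- suffices, apart from a few cases in which (a , a , a) or (a , b , a , b) can be reached.

module Submission where

open import Defs
open import Data.Bool using (Bool; true; false; _∧_; _∨_; not; T; if_then_else_)
open import Data.Bool.ListAction using (any)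
open import Data.Bool.Properties using (T-∧; T-∨)
open import Data.Empty using (⊥; ⊥-elim)
open import Data.Fin using (Fin; zero; suc; toℕ; inject₁; fromℕ; opposite)
open import Data.Fin.Induction using (<-weakInduction)
open import Data.Fin.Patterns
open import Data.Fin.Properties using (all?; opposite-involutive)
open import Data.Fin.Relation.Unary.Top using (view; view-fromℕ; view-inject₁; ‵fromℕ; ‵inj₁)
open import Data.List using (List; []; _∷_; _++_; concatMap; length; lookup; tabulate; reverse)
open import Data.List.Properties
  using (++-identityʳ; length-tabulate; tabulate-cong; tabulate-lookup; unfold-reverse)
open import Data.List.Relation.Unary.All as All using (All; []; _∷_)
open import Data.List.Relation.Unary.All.Properties using (++⁺)
open import Data.List.Relation.Unary.Any.Properties using (any⁻)
open import Data.Maybe using (Maybe; just; nothing)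
open import Data.Maybe.Relation.Unary.All as Maybe using (just; nothing)
open import Data.Nat
open import Data.Nat.Divisibility using (_∣_; divides)
open import Data.Nat.Induction using (<-wellFounded)
open import Data.Nat.ListAction using (sum)
open import Data.Nat.Properties
open import Data.Nat.Tactic.RingSolver using (solve-∀)
open import Data.Product using (Σ-syntax; ∃-syntax; _×_; _,_; proj₁; proj₂)
open import Data.Sum using (_⊎_; inj₁; inj₂; [_,_]′)
open import Data.Unit using (⊤)
open import Data.Vec as Vec using (Vec; []; _∷_)
open import Function using (_∘_; id)
open import Function.Bundles using (_⇔_; mk⇔; Equivalence)
open import Induction.WellFounded using (Acc; acc)
open import Relation.Binary.Definitions using (tri<; tri≈; tri>)
open import Relation.Binary.PropositionalEquality
open import Relation.Nullary using (¬_; Dec; yes; no; contradiction)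
open import Relation.Nullary.Decidable
  using (True; toWitness; decidable-stable; _×-dec_; _⊎-dec_; _→-dec_)

-- Fourier-Motzkin elimination with natural coefficients

Coeffs : ℕ → Set
Coeffs n = Vec ℕ (suc n)

-- The last entry is the constant term, so a coefficient vector is an affine form.
eval : ∀ {n} → Vec ℕ n → Coeffs n → ℕ
eval [] (c ∷ []) = c
eval (x ∷ ρ) (a ∷ u) = a * x + eval ρ u

combine : ∀ {n} → ℕ → ℕ → Coeffs n → Coeffs n → Coeffs n
combine a b = Vec.zipWith (λ x y → a * x + b * y)

monus : ∀ {n} → Coeffs n → Coeffs n → Coeffs n
monus = Vec.zipWith _∸_

eval-combine : ∀ {n} a b (ρ : Vec ℕ n) u v →
               eval ρ (combine a b u v) ≡ a * eval ρ u + b * eval ρ v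
eval-combine a b [] (c ∷ []) (d ∷ []) = refl
eval-combine a b (x ∷ ρ) (c ∷ u) (d ∷ v)
  rewrite eval-combine a b ρ u v = regroup a b c d x (eval ρ u) (eval ρ v)
  where
  regroup : ∀ a b c d x y z → (a * c + b * d) * x + (a * y + b * z) ≡ a * (c * x + y) + b * (d * x + z)
  regroup = solve-∀

-- Both sides are the maximum of m and n.
monus-swap : ∀ m n → (m ∸ n) + n ≡ (n ∸ m) + m
monus-swap zero zero = refl
monus-swap zero (suc n) = sym (+-identityʳ (suc n))
monus-swap (suc m) zero = +-identityʳ (suc m)
monus-swap (suc m) (suc n)
  rewrite +-suc (m ∸ n) n | +-suc (n ∸ m) m = cong suc (monus-swap m n)

-- Both sides evaluate the coordinatewise maximum of u and v. This replaces subtraction of common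
-- parts, which natural coefficients do not allow.
eval-monus : ∀ {n} (ρ : Vec ℕ n) u v →
             eval ρ (monus u v) + eval ρ v ≡ eval ρ (monus v u) + eval ρ u
eval-monus [] (c ∷ []) (d ∷ []) = monus-swap c d
eval-monus (x ∷ ρ) (c ∷ u) (d ∷ v) = begin
  ((c ∸ d) * x + eval ρ (monus u v)) + (d * x + eval ρ v) ≡⟨ regroup (c ∸ d) d x _ _ ⟩
  ((c ∸ d) + d) * x + (eval ρ (monus u v) + eval ρ v)     ≡⟨ cong₂ _+_ (cong (_* x) (monus-swap c d)) (eval-monus ρ u v) ⟩
  ((d ∸ c) + c) * x + (eval ρ (monus v u) + eval ρ u)     ≡⟨ regroup (d ∸ c) c x _ _ ⟨
  ((d ∸ c) * x + eval ρ (monus v u)) + (c * x + eval ρ u) ∎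
  where
  open ≡-Reasoning
  regroup : ∀ a b x y z → (a * x + y) + (b * x + z) ≡ (a + b) * x + (y + z)
  regroup = solve-∀

-- Both sides have coefficients in ℕ; cancel leaves each variable on one side only.
infix 4 _⊴_

data Row (n : ℕ) : Set where
  _⊴_ : Coeffs n → Coeffs n → Row n

-- What `_≤_` and `_≡_` share, so that the soundness of combining rows is proved once for both.
record Linear (_∼_ : ℕ → ℕ → Set) : Set where
  field
    ∼-refl   : ∀ {a} → a ∼ a
    +-mono   : ∀ {a b c d} → a ∼ b → c ∼ d → (a + c) ∼ (b + d)
    *-mono   : ∀ c {a b} → a ∼ b → (c * a) ∼ (c * b)
    ∼-cancel : ∀ c {a b} → (a + c) ∼ (b + c) → a ∼ b

Holds : (ℕ → ℕ → Set) → ∀ {n} → Vec ℕ n → Row n → Set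
Holds _∼_ ρ (u ⊴ v) = eval ρ u ∼ eval ρ v

flip : ∀ {n} → Row n → Row n
flip (u ⊴ v) = v ⊴ u

cancel : ∀ {n} → Row n → Row n
cancel (u ⊴ v) = monus u v ⊴ monus v u

mix : ∀ {n} → ℕ → ℕ → Row n → Row n → Row n
mix a b (u ⊴ v) (u′ ⊴ v′) = cancel (combine a b u u′ ⊴ combine a b v v′)

≤-linear : Linear _≤_
≤-linear = record
  { ∼-refl = ≤-refl
  ; +-mono = +-mono-≤
  ; *-mono = λ c → *-monoʳ-≤ c
  ; ∼-cancel = λ c → +-cancelʳ-≤ c _ _
  }

≡-linear : Linear _≡_
≡-linear = record
  { ∼-refl = refl
  ; +-mono = cong₂ _+_
  ; *-mono = λ c → cong (c *_)
  ; ∼-cancel = λ c → +-cancelʳ-≡ c _ _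
  }

module _ {_∼_ : ℕ → ℕ → Set} (lin : Linear _∼_) where
  open Linear lin

  cancel-sound : ∀ {n} (ρ : Vec ℕ n) C → Holds _∼_ ρ C → Holds _∼_ ρ (cancel C)
  cancel-sound ρ (u ⊴ v) h =
    ∼-cancel (eval ρ v) (subst (_∼ (eval ρ (monus v u) + eval ρ v)) (sym (eval-monus ρ u v)) (+-mono ∼-refl h))

  mix-sound : ∀ {n} (ρ : Vec ℕ n) a b C D → Holds _∼_ ρ C → Holds _∼_ ρ D → Holds _∼_ ρ (mix a b C D)
  mix-sound ρ a b (u ⊴ v) (u′ ⊴ v′) h h′ =
    cancel-sound ρ (combine a b u u′ ⊴ combine a b v v′)
      (subst₂ _∼_ (sym (eval-combine a b ρ u u′)) (sym (eval-combine a b ρ v v′))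
        (+-mono (*-mono a h) (*-mono b h′)))

≡⇒Linear : ∀ {_∼_} → Linear _∼_ → ∀ {a b} → a ≡ b → a ∼ b
≡⇒Linear lin refl = Linear.∼-refl lin

-- E must be oriented as by pivot: its leading variable occurs only on the left.
substitute : ∀ {n} → Row (suc n) → Row (suc n) → Row (suc n)
substitute E@(a ∷ _ ⊴ _) C@(l ∷ _ ⊴ r ∷ _) = mix 1 l (mix a r C E) (flip E)

substitute-sound : ∀ {_∼_} → Linear _∼_ → ∀ {n} {ρ : Vec ℕ (suc n)} E C →
                   Holds _≡_ ρ E → Holds _∼_ ρ C → Holds _∼_ ρ (substitute E C)
substitute-sound lin {ρ = ρ} E@(a ∷ _ ⊴ _) C@(l ∷ _ ⊴ r ∷ _) e h =
  mix-sound lin ρ 1 l (mix a r C E) (flip E)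
    (mix-sound lin ρ a r C E h (≡⇒Linear lin e)) (≡⇒Linear lin (sym e))

-- The Fourier-Motzkin step: C bounds the leading variable from below and D from above. The crossed
-- multipliers equalise its coefficients, so that in cancelled rows the variable disappears.
resolve : ∀ {n} → Row (suc n) → Row (suc n) → List (Row (suc n))
resolve C@(_ ⊴ suc r ∷ _) D@(suc l ∷ _ ⊴ _) = mix (suc l) (suc r) C D ∷ []
resolve _ _ = []

resolve-sound : ∀ {n} {ρ : Vec ℕ (suc n)} C D → Holds _≤_ ρ C → Holds _≤_ ρ D →
                All (Holds _≤_ ρ) (resolve C D)
resolve-sound {ρ = ρ} C@(_ ⊴ suc r ∷ _) D@(suc l ∷ _ ⊴ _) h h′ = mix-sound ≤-linear ρ (suc l) (suc r) C D h h′ ∷ []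
resolve-sound (_ ⊴ suc _ ∷ _) (zero ∷ _ ⊴ _) _ _ = []
resolve-sound (_ ⊴ zero ∷ _) _ _ _ = []

zeros : ∀ {n} → Vec ℕ n → Bool
zeros [] = true
zeros (zero ∷ u) = zeros u
zeros (suc _ ∷ _) = false

-- A variable on the smaller side may be dropped because it is nonnegative.
drop≤ : ∀ {n} → Row (suc n) → List (Row n)
drop≤ (_ ∷ u ⊴ zero ∷ v) = if zeros u then [] else (u ⊴ v) ∷ []
drop≤ (_ ∷ _ ⊴ suc _ ∷ _) = []

drop≤-sound : ∀ {n x} {ρ : Vec ℕ n} C → Holds _≤_ (x ∷ ρ) C → All (Holds _≤_ ρ) (drop≤ C)
drop≤-sound (_ ∷ u ⊴ zero ∷ v) h with zeros u
... | true = []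
... | false = m+n≤o⇒n≤o _ h ∷ []
drop≤-sound (_ ∷ _ ⊴ suc _ ∷ _) h = []

drop≡ : ∀ {n} → Row (suc n) → List (Row n)
drop≡ (zero ∷ u ⊴ zero ∷ v) = (u ⊴ v) ∷ []
drop≡ _ = []

drop≡-sound : ∀ {n x} {ρ : Vec ℕ n} C → Holds _≡_ (x ∷ ρ) C → All (Holds _≡_ ρ) (drop≡ C)
drop≡-sound (zero ∷ u ⊴ zero ∷ v) h = h ∷ []
drop≡-sound (zero ∷ _ ⊴ suc _ ∷ _) h = []
drop≡-sound (suc _ ∷ _ ⊴ _ ∷ _) h = []

pivot : ∀ {n} → List (Row (suc n)) → Maybe (Row (suc n))
pivot [] = nothing
pivot (E@(suc _ ∷ _ ⊴ _) ∷ _) = just E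
pivot (E@(zero ∷ _ ⊴ suc _ ∷ _) ∷ _) = just (flip E)
pivot ((zero ∷ _ ⊴ zero ∷ _) ∷ Es) = pivot Es

pivot-sound : ∀ {n} {ρ : Vec ℕ (suc n)} Es → All (Holds _≡_ ρ) Es → Maybe.All (Holds _≡_ ρ) (pivot Es)
pivot-sound [] [] = nothing
pivot-sound ((suc _ ∷ _ ⊴ _) ∷ _) (h ∷ _) = just h
pivot-sound ((zero ∷ _ ⊴ suc _ ∷ _) ∷ _) (h ∷ _) = just (sym h)
pivot-sound ((zero ∷ _ ⊴ zero ∷ _) ∷ Es) (_ ∷ hs) = pivot-sound Es hs

record System (n : ℕ) : Set where
  constructor system
  field
    equations    : List (Row n)
    inequalities : List (Row n)

record Solves {n} (ρ : Vec ℕ n) (S : System n) : Set where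
  constructor solves
  field
    equations    : All (Holds _≡_ ρ) (System.equations S)
    inequalities : All (Holds _≤_ ρ) (System.inequalities S)

-- An equation containing the variable is preferred, since substitution does not increase the number
-- of rows while pairing bounds may square it. Only soundness is claimed: the nonnegativity of a
-- substituted variable, for instance, is not recorded.
eliminate : ∀ {n} → System (suc n) → System n
eliminate (system es is) with pivot es
... | just E = system (concatMap (drop≡ ∘ substitute E) es) (concatMap (drop≤ ∘ substitute E) is)
... | nothing = system (concatMap drop≡ es)
  (concatMap drop≤ is ++ concatMap (λ C → concatMap (concatMap drop≤ ∘ resolve C) is) is)

all-concatMap : ∀ {A B : Set} {P : A → Set} {Q : B → Set} {f : A → List B} →
                (∀ x → P x → All Q (f x)) → ∀ {xs} → All P xs → All Q (concatMap f xs)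
all-concatMap h [] = []
all-concatMap h (p ∷ ps) = ++⁺ (h _ p) (all-concatMap h ps)

eliminate-sound : ∀ {n x} {ρ : Vec ℕ n} S → Solves (x ∷ ρ) S → Solves ρ (eliminate S)
eliminate-sound (system es is) (solves hes his) with pivot es | pivot-sound es hes
... | just E | just e = solves
  (all-concatMap (λ C h → drop≡-sound (substitute E C) (substitute-sound ≡-linear E C e h)) hes)
  (all-concatMap (λ C h → drop≤-sound (substitute E C) (substitute-sound ≤-linear E C e h)) his)
... | nothing | nothing = solves
  (all-concatMap drop≡-sound hes)
  (++⁺ (all-concatMap drop≤-sound his)
       (all-concatMap (λ C h → all-concatMap (λ D h′ → all-concatMap drop≤-sound (resolve-sound C D h h′)) his) his))

false≡ false≤ : Row 0 → Bool
false≡ (c ∷ [] ⊴ d ∷ []) = not (c ≡ᵇ d)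
false≤ (c ∷ [] ⊴ d ∷ []) = d <ᵇ c

false≡-sound : ∀ C → Holds _≡_ [] C → T (false≡ C) → ⊥
false≡-sound (c ∷ [] ⊴ d ∷ []) h t with c ≡ᵇ d | ≡⇒≡ᵇ c d h
... | true | _ = t

false≤-sound : ∀ C → Holds _≤_ [] C → T (false≤ C) → ⊥
false≤-sound (c ∷ [] ⊴ d ∷ []) h t = <⇒≱ (<ᵇ⇒< d c t) h

contradictory : System 0 → Bool
contradictory (system es is) = any false≡ es ∨ any false≤ is

contradictory-sound : ∀ S → T (contradictory S) → Solves [] S → ⊥
contradictory-sound (system es is) t (solves hes his) with Equivalence.to (T-∨ {any false≡ es}) t
... | inj₁ u = All.lookupWith {R = λ _ → ⊥} (λ {C} → false≡-sound C) hes (any⁻ false≡ es u)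
... | inj₂ u = All.lookupWith {R = λ _ → ⊥} (λ {C} → false≤-sound C) his (any⁻ false≤ is u)

inconsistent : ∀ {n} → System n → Bool
inconsistent {zero} S = contradictory S
inconsistent {suc n} S = inconsistent (eliminate S)

inconsistent-sound : ∀ {n} (ρ : Vec ℕ n) S → T (inconsistent S) → Solves ρ S → ⊥
inconsistent-sound [] S t = contradictory-sound S t
inconsistent-sound (x ∷ ρ) S t = inconsistent-sound ρ (eliminate S) t ∘ eliminate-sound S

-- Deciding linear formulas by reflection

infixl 6 _⊕_
infix 4 _≈_ _≼_ _≺_
infixr 3 _&_
infixr 2 _or_

data Term (n : ℕ) : Set where
  var : Fin n → Term n
  con : ℕ → Term n
  _⊕_ : Term n → Term n → Term n

-- There is no negation: a disequality enters as a disjunction of strict inequalities, so every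
-- branch is a plain system of rows.
data Formula (n : ℕ) : Set where
  _≈_ _≼_  : Term n → Term n → Formula n
  _&_ _or_ : Formula n → Formula n → Formula n

_≺_ : ∀ {n} → Term n → Term n → Formula n
s ≺ t = con 1 ⊕ s ≼ t

⟦_⟧ₜ : ∀ {n} → Term n → Vec ℕ n → ℕ
⟦ var i ⟧ₜ ρ = Vec.lookup ρ i
⟦ con c ⟧ₜ ρ = c
⟦ s ⊕ t ⟧ₜ ρ = ⟦ s ⟧ₜ ρ + ⟦ t ⟧ₜ ρ

⟦_⟧ : ∀ {n} → Formula n → Vec ℕ n → Set
⟦ s ≈ t ⟧ ρ = ⟦ s ⟧ₜ ρ ≡ ⟦ t ⟧ₜ ρ
⟦ s ≼ t ⟧ ρ = ⟦ s ⟧ₜ ρ ≤ ⟦ t ⟧ₜ ρ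
⟦ φ & ψ ⟧ ρ = ⟦ φ ⟧ ρ × ⟦ ψ ⟧ ρ
⟦ φ or ψ ⟧ ρ = ⟦ φ ⟧ ρ ⊎ ⟦ ψ ⟧ ρ

constant : ∀ {n} → ℕ → Coeffs n
constant {zero} c = c ∷ []
constant {suc n} c = 0 ∷ constant c

unit : ∀ {n} → Fin n → Coeffs n
unit zero = 1 ∷ constant 0
unit (suc i) = 0 ∷ unit i

linearise : ∀ {n} → Term n → Coeffs n
linearise (var i) = unit i
linearise (con c) = constant c
linearise (s ⊕ t) = combine 1 1 (linearise s) (linearise t)

eval-constant : ∀ {n} (ρ : Vec ℕ n) c → eval ρ (constant c) ≡ c
eval-constant [] c = refl
eval-constant (x ∷ ρ) c = eval-constant ρ c

eval-variable : ∀ {n} (ρ : Vec ℕ n) i → eval ρ (unit i) ≡ Vec.lookup ρ i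
eval-variable (x ∷ ρ) zero rewrite eval-constant ρ 0 = trans (+-identityʳ _) (+-identityʳ x)
eval-variable (x ∷ ρ) (suc i) = eval-variable ρ i

eval-linearise : ∀ {n} (ρ : Vec ℕ n) t → eval ρ (linearise t) ≡ ⟦ t ⟧ₜ ρ
eval-linearise ρ (var i) = eval-variable ρ i
eval-linearise ρ (con c) = eval-constant ρ c
eval-linearise ρ (s ⊕ t)
  rewrite eval-combine 1 1 ρ (linearise s) (linearise t)
        | +-identityʳ (eval ρ (linearise s)) | +-identityʳ (eval ρ (linearise t))
  = cong₂ _+_ (eval-linearise ρ s) (eval-linearise ρ t)

row : ∀ {n} → Term n → Term n → Row n
row s t = cancel (linearise s ⊴ linearise t)

row-sound : ∀ {_∼_} → Linear _∼_ → ∀ {n} {ρ : Vec ℕ n} s t →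
            ⟦ s ⟧ₜ ρ ∼ ⟦ t ⟧ₜ ρ → Holds _∼_ ρ (row s t)
row-sound {_∼_} lin {ρ = ρ} s t h = cancel-sound lin ρ (linearise s ⊴ linearise t)
  (subst₂ _∼_ (sym (eval-linearise ρ s)) (sym (eval-linearise ρ t)) h)

-- The continuation expands the disjunctive normal form branch by branch; k receives the rows
-- collected along one branch.
refute : ∀ {n} → Formula n → (System n → Bool) → System n → Bool
refute (s ≈ t) k (system es is) = k (system (row s t ∷ es) is)
refute (s ≼ t) k (system es is) = k (system es (row s t ∷ is))
refute (φ & ψ) k = refute φ (refute ψ k)
refute (φ or ψ) k S = refute φ k S ∧ refute ψ k S

Refutes : ∀ {n} → Vec ℕ n → (System n → Bool) → Set
Refutes ρ k = ∀ S → T (k S) → Solves ρ S → ⊥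

refute-sound : ∀ {n} {ρ : Vec ℕ n} φ {k} → ⟦ φ ⟧ ρ → Refutes ρ k → Refutes ρ (refute φ k)
refute-sound (s ≈ t) p r (system es is) u (solves hes his) =
  r _ u (solves (row-sound ≡-linear s t p ∷ hes) his)
refute-sound (s ≼ t) p r (system es is) u (solves hes his) =
  r _ u (solves hes (row-sound ≤-linear s t p ∷ his))
refute-sound (φ & ψ) (p , q) r = refute-sound φ p (refute-sound ψ q r)
refute-sound (φ or ψ) (inj₁ p) r S u = refute-sound φ p r S (proj₁ (Equivalence.to T-∧ u))
refute-sound (φ or ψ) {k} (inj₂ q) r S u = refute-sound ψ q r S (proj₂ (Equivalence.to (T-∧ {refute φ k S}) u))

-- Each branch of φ is tested before ψ splits it, so the cases of ψ multiply only the branches that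
-- survive.
unsatisfiable : ∀ {n} → Formula n → Formula n → Bool
unsatisfiable φ ψ = refute φ (λ S → inconsistent S ∨ refute ψ inconsistent S) (system [] [])

-- Proof by reflection: for closed φ and ψ the hidden argument computes to the unit type and is
-- filled in by evaluation.
contradiction-by : ∀ {n} (φ ψ : Formula n) {_ : T (unsatisfiable φ ψ)} (ρ : Vec ℕ n) →
                   ⟦ φ ⟧ ρ → ⟦ ψ ⟧ ρ → ⊥
contradiction-by φ ψ {t} ρ p q = refute-sound φ p k-sound (system [] []) t (solves [] [])
  where
  k-sound : Refutes ρ (λ S → inconsistent S ∨ refute ψ inconsistent S)
  k-sound S u h with Equivalence.to (T-∨ {inconsistent S}) u
  ... | inj₁ v = inconsistent-sound ρ S v h
  ... | inj₂ v = refute-sound ψ q (inconsistent-sound ρ) S v h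

-- Cold positions and their symmetries

-- h is the half, rounded down, of the repeated least pile of families (5)–(8), which witnesses
-- its parity; the three last alternatives are (7), (8) and the reflection of (8).
canonical : ∀ {n} (h x₀ x₁ x₂ x₃ x₄ : Term n) → Formula n
canonical h x₀ x₁ x₂ x₃ x₄ =
     (x₁ ≈ x₄ & x₀ ⊕ x₁ ≈ x₂ ⊕ x₃ & x₁ ≺ x₂ & x₂ ≺ x₀ & x₁ ≺ x₃ & x₃ ≺ x₀)
  or (x₂ ≈ x₃ & x₁ ≈ x₄ & x₀ ≈ con 1 ⊕ x₂ &
        ((x₂ ≈ h ⊕ h & con 2 ⊕ x₂ ≼ x₁) or (x₂ ≈ con 1 ⊕ (h ⊕ h) & con 3 ⊕ x₂ ≼ x₁)))
  or (x₂ ≈ x₃ & x₂ ≈ con 1 ⊕ (h ⊕ h) &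
        ( (x₀ ≈ con 2 ⊕ x₂ & x₁ ≈ con 1 ⊕ x₂ & x₄ ≈ con 1 ⊕ x₂)
       or (x₀ ≈ con 1 ⊕ x₂ & x₁ ≈ con 1 ⊕ x₂ & x₄ ≈ con 2 ⊕ x₂)
       or (x₀ ≈ con 1 ⊕ x₂ & x₁ ≈ con 2 ⊕ x₂ & x₄ ≈ con 1 ⊕ x₂)))

-- Rotations suffice, because `canonical` is closed under the reflection fixing x₀
-- (`Canonical-flip`).
pentagon : ∀ {n} (h x₀ x₁ x₂ x₃ x₄ : Term n) → Formula n
pentagon h x₀ x₁ x₂ x₃ x₄ =
     canonical h x₀ x₁ x₂ x₃ x₄
  or canonical h x₁ x₂ x₃ x₄ x₀
  or canonical h x₂ x₃ x₄ x₀ x₁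
  or canonical h x₃ x₄ x₀ x₁ x₂
  or canonical h x₄ x₀ x₁ x₂ x₃

Canonical Pentagon : (h x₀ x₁ x₂ x₃ x₄ : ℕ) → Set
Canonical h x₀ x₁ x₂ x₃ x₄ =
  ⟦ canonical (var 0F) (var 1F) (var 2F) (var 3F) (var 4F) (var 5F) ⟧ (h ∷ x₀ ∷ x₁ ∷ x₂ ∷ x₃ ∷ x₄ ∷ [])
Pentagon h x₀ x₁ x₂ x₃ x₄ =
  ⟦ pentagon (var 0F) (var 1F) (var 2F) (var 3F) (var 4F) (var 5F) ⟧ (h ∷ x₀ ∷ x₁ ∷ x₂ ∷ x₃ ∷ x₄ ∷ [])

Cold : Config → Set
Cold [] = ⊤
Cold (x ∷ y ∷ z ∷ []) = x ≡ y × y ≡ z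
Cold (w ∷ x ∷ y ∷ z ∷ []) = w ≡ y × x ≡ z × w ≢ x
Cold (x₀ ∷ x₁ ∷ x₂ ∷ x₃ ∷ x₄ ∷ []) = ∃[ h ] Pentagon h x₀ x₁ x₂ x₃ x₄
Cold _ = ⊥

Cold-rot1 : ∀ c → Cold c → Cold (rot1 c)
Cold-rot1 [] p = p
Cold-rot1 (x ∷ y ∷ z ∷ []) (refl , refl) = refl , refl
Cold-rot1 (w ∷ x ∷ y ∷ z ∷ []) (refl , refl , w≢x) = refl , refl , w≢x ∘ sym
Cold-rot1 (_ ∷ _ ∷ _ ∷ _ ∷ _ ∷ []) (h , inj₁ p) = h , inj₂ (inj₂ (inj₂ (inj₂ p)))
Cold-rot1 (_ ∷ _ ∷ _ ∷ _ ∷ _ ∷ []) (h , inj₂ (inj₁ p)) = h , inj₁ p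
Cold-rot1 (_ ∷ _ ∷ _ ∷ _ ∷ _ ∷ []) (h , inj₂ (inj₂ (inj₁ p))) = h , inj₂ (inj₁ p)
Cold-rot1 (_ ∷ _ ∷ _ ∷ _ ∷ _ ∷ []) (h , inj₂ (inj₂ (inj₂ (inj₁ p)))) = h , inj₂ (inj₂ (inj₁ p))
Cold-rot1 (_ ∷ _ ∷ _ ∷ _ ∷ _ ∷ []) (h , inj₂ (inj₂ (inj₂ (inj₂ p)))) = h , inj₂ (inj₂ (inj₂ (inj₁ p)))

Cold-rot : ∀ n c → Cold c → Cold (rot n c)
Cold-rot zero c p = p
Cold-rot (suc n) c p = Cold-rot n (rot1 c) (Cold-rot1 c p)

Canonical-flip : ∀ h {x₀ x₁ x₂ x₃ x₄} → Canonical h x₀ x₁ x₂ x₃ x₄ → Canonical h x₀ x₄ x₃ x₂ x₁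
Canonical-flip h {x₂ = x₂} {x₃} (inj₁ (refl , e , a , b , c , d)) = inj₁ (refl , trans e (+-comm x₂ x₃) , c , d , a , b)
Canonical-flip h (inj₂ (inj₁ (refl , refl , p))) = inj₂ (inj₁ (refl , refl , p))
Canonical-flip h (inj₂ (inj₂ (refl , o , inj₁ (p , q , r)))) = inj₂ (inj₂ (refl , o , inj₁ (p , r , q)))
Canonical-flip h (inj₂ (inj₂ (refl , o , inj₂ (inj₁ (p , q , r))))) = inj₂ (inj₂ (refl , o , inj₂ (inj₂ (p , r , q))))
Canonical-flip h (inj₂ (inj₂ (refl , o , inj₂ (inj₂ (p , q , r))))) = inj₂ (inj₂ (refl , o , inj₂ (inj₁ (p , r , q))))

Cold-reverse : ∀ c → Cold c → Cold (reverse c)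
Cold-reverse [] p = p
Cold-reverse (x ∷ y ∷ z ∷ []) (refl , refl) = refl , refl
Cold-reverse (w ∷ x ∷ y ∷ z ∷ []) (refl , refl , w≢x) = refl , refl , w≢x ∘ sym
Cold-reverse (_ ∷ _ ∷ _ ∷ _ ∷ _ ∷ []) (h , inj₁ p) = h , inj₂ (inj₂ (inj₂ (inj₂ (Canonical-flip h p))))
Cold-reverse (_ ∷ _ ∷ _ ∷ _ ∷ _ ∷ []) (h , inj₂ (inj₁ p)) = h , inj₂ (inj₂ (inj₂ (inj₁ (Canonical-flip h p))))
Cold-reverse (_ ∷ _ ∷ _ ∷ _ ∷ _ ∷ []) (h , inj₂ (inj₂ (inj₁ p))) = h , inj₂ (inj₂ (inj₁ (Canonical-flip h p)))
Cold-reverse (_ ∷ _ ∷ _ ∷ _ ∷ _ ∷ []) (h , inj₂ (inj₂ (inj₂ (inj₁ p)))) = h , inj₂ (inj₁ (Canonical-flip h p))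
Cold-reverse (_ ∷ _ ∷ _ ∷ _ ∷ _ ∷ []) (h , inj₂ (inj₂ (inj₂ (inj₂ p)))) = h , inj₁ (Canonical-flip h p)

-- Cold positions versus listed positions up to symmetry

Positive : Config → Set
Positive = All (1 ≤_)

Good : Config → Set
Good c = Σ[ c₀ ∈ Config ] (Listed c₀ × SameConfig c₀ c)

halve : ∀ m → ∃[ h ] (m ≡ h + h ⊎ m ≡ 1 + (h + h))
halve zero = 0 , inj₁ refl
halve (suc m) with halve m
... | h , inj₁ e = h , inj₂ (cong suc e)
... | h , inj₂ e = suc h , inj₁ (cong suc (trans e (sym (+-suc h h))))

double : ∀ h → h * 2 ≡ h + h
double = solve-∀

even⇒2∣ : ∀ {m} h → m ≡ h + h → 2 ∣ m
even⇒2∣ h e = divides h (trans e (sym (double h)))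

odd⇒¬2∣ : ∀ {m} h → m ≡ 1 + (h + h) → ¬ (2 ∣ m)
odd⇒¬2∣ {m} h e (divides q e′) = contradiction-by
  (var 2F ≈ con 1 ⊕ (var 0F ⊕ var 0F) & var 2F ≈ var 1F ⊕ var 1F)
  -- 1 + 2h = 2q has rational solutions; separating h < q from q ≤ h supplies the integrality.
  (var 0F ≺ var 1F or var 1F ≼ var 0F) (h ∷ q ∷ m ∷ [])
  (e , trans e′ (double q)) (<-≤-connex h q)

2∣⇒even : ∀ {m} → 2 ∣ m → ∃[ h ] m ≡ h + h
2∣⇒even (divides q e) = q , trans e (double q)

¬2∣⇒odd : ∀ {m} → ¬ (2 ∣ m) → ∃[ h ] m ≡ 1 + (h + h)
¬2∣⇒odd {m} o with halve m
... | h , inj₁ e = contradiction (even⇒2∣ h e) o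
... | h , inj₂ e = h , e

Listed⇒Cold : ∀ {c} → Listed c → Cold c
Listed⇒Cold f1 = _
Listed⇒Cold (f2 a _) = refl , refl
Listed⇒Cold (f3 a b _ _ a≢b) = refl , refl , a≢b
Listed⇒Cold (f4 M m a b _ m<a a<M m<b b<M e) =
  -- The family `f4` involves no parity, so h is given the default value 0.
  0 , inj₁ (inj₁ (refl , trans (+-comm M m) e , m<a , a<M , m<b , b<M))
Listed⇒Cold (f5 m M _ even le) with 2∣⇒even even
... | h , e = h , inj₁ (inj₂ (inj₁ (refl , refl , refl , inj₁ (e , subst (_≤ M) (+-comm m 2) le))))
Listed⇒Cold (f6 m M _ odd le) with ¬2∣⇒odd odd
... | h , e = h , inj₁ (inj₂ (inj₁ (refl , refl , refl , inj₂ (e , subst (_≤ M) (+-comm m 3) le))))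
Listed⇒Cold (f7 m _ odd) with ¬2∣⇒odd odd
... | h , e = h , inj₁ (inj₂ (inj₂ (refl , e , inj₁ (+-comm m 2 , +-comm m 1 , +-comm m 1))))
Listed⇒Cold (f8 m _ odd) with ¬2∣⇒odd odd
... | h , e = h , inj₁ (inj₂ (inj₂ (refl , e , inj₂ (inj₁ (+-comm m 1 , +-comm m 1 , +-comm m 2)))))

Good⇒Cold : ∀ {c} → Good c → Cold c
Good⇒Cold (c₀ , l , n , inj₁ refl) = Cold-rot n c₀ (Listed⇒Cold l)
Good⇒Cold (c₀ , l , n , inj₂ refl) = Cold-rot n (reverse c₀) (Cold-reverse c₀ (Listed⇒Cold l))

rot-suc : ∀ n c → rot1 (rot n c) ≡ rot (suc n) c
rot-suc zero c = refl
rot-suc (suc n) c = rot-suc n (rot1 c)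

Good-rot1 : ∀ {c} → Good c → Good (rot1 c)
Good-rot1 (c₀ , l , n , inj₁ refl) = c₀ , l , suc n , inj₁ (rot-suc n c₀)
Good-rot1 (c₀ , l , n , inj₂ refl) = c₀ , l , suc n , inj₂ (rot-suc n (reverse c₀))

Good-rot : ∀ n {c} → Good c → Good (rot n c)
Good-rot zero g = g
Good-rot (suc n) g = Good-rot n (Good-rot1 g)

Listed⇒Good : ∀ {c} → Listed c → Good c
Listed⇒Good l = _ , l , 0 , inj₁ refl

Canonical⇒Good : ∀ h {x₀ x₁ x₂ x₃ x₄} → Positive (x₀ ∷ x₁ ∷ x₂ ∷ x₃ ∷ x₄ ∷ []) →
                 Canonical h x₀ x₁ x₂ x₃ x₄ → Good (x₀ ∷ x₁ ∷ x₂ ∷ x₃ ∷ x₄ ∷ [])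
Canonical⇒Good h {x₀ = M} {m} (_ ∷ pm ∷ _) (inj₁ (refl , e , m<a , a<M , m<b , b<M)) =
  Listed⇒Good (f4 _ _ _ _ pm m<a a<M m<b b<M (trans (+-comm m M) e))
Canonical⇒Good h {x₁ = M} {m} (_ ∷ _ ∷ pm ∷ _) (inj₂ (inj₁ (refl , refl , refl , inj₁ (e , le)))) =
  Listed⇒Good (f5 m M pm (even⇒2∣ h e) (subst (_≤ M) (+-comm 2 m) le))
Canonical⇒Good h {x₁ = M} {m} (_ ∷ _ ∷ pm ∷ _) (inj₂ (inj₁ (refl , refl , refl , inj₂ (e , le)))) =
  Listed⇒Good (f6 m M pm (odd⇒¬2∣ h e) (subst (_≤ M) (+-comm 3 m) le))
Canonical⇒Good h {x₂ = m} (_ ∷ _ ∷ pm ∷ _) (inj₂ (inj₂ (refl , e , inj₁ (refl , refl , refl))))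
  rewrite +-comm 2 m | +-comm 1 m = Listed⇒Good (f7 m pm (odd⇒¬2∣ h e))
Canonical⇒Good h {x₂ = m} (_ ∷ _ ∷ pm ∷ _) (inj₂ (inj₂ (refl , e , inj₂ (inj₁ (refl , refl , refl)))))
  rewrite +-comm 2 m | +-comm 1 m = Listed⇒Good (f8 m pm (odd⇒¬2∣ h e))
Canonical⇒Good h {x₂ = m} (_ ∷ _ ∷ pm ∷ _) (inj₂ (inj₂ (refl , e , inj₂ (inj₂ (refl , refl , refl)))))
  -- Reversal sends the first pile to the end and four rotations bring it back, so together they
  -- reflect the circle about its first pile.
  rewrite +-comm 2 m | +-comm 1 m = _ , f8 m pm (odd⇒¬2∣ h e) , 4 , inj₂ refl

Cold⇒Good : ∀ {c} → Positive c → Cold c → Good c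
Cold⇒Good {[]} _ _ = Listed⇒Good f1
Cold⇒Good {x ∷ y ∷ z ∷ []} (p ∷ _) (refl , refl) = Listed⇒Good (f2 x p)
Cold⇒Good {w ∷ x ∷ y ∷ z ∷ []} (p ∷ q ∷ _) (refl , refl , w≢x) = Listed⇒Good (f3 w x p q w≢x)
Cold⇒Good {_ ∷ _ ∷ _ ∷ _ ∷ _ ∷ []} (p₀ ∷ p₁ ∷ p₂ ∷ p₃ ∷ p₄ ∷ []) (h , k) with k
... | inj₁ g = Canonical⇒Good h (p₀ ∷ p₁ ∷ p₂ ∷ p₃ ∷ p₄ ∷ []) g
... | inj₂ (inj₁ g) = Good-rot 4 (Canonical⇒Good h (p₁ ∷ p₂ ∷ p₃ ∷ p₄ ∷ p₀ ∷ []) g)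
... | inj₂ (inj₂ (inj₁ g)) = Good-rot 3 (Canonical⇒Good h (p₂ ∷ p₃ ∷ p₄ ∷ p₀ ∷ p₁ ∷ []) g)
... | inj₂ (inj₂ (inj₂ (inj₁ g))) = Good-rot 2 (Canonical⇒Good h (p₃ ∷ p₄ ∷ p₀ ∷ p₁ ∷ p₂ ∷ []) g)
... | inj₂ (inj₂ (inj₂ (inj₂ g))) = Good-rot 1 (Canonical⇒Good h (p₄ ∷ p₀ ∷ p₁ ∷ p₂ ∷ p₃ ∷ []) g)

-- Moves under rotation and reflection

inWindow? : ∀ {r} (i j : Fin r) → Dec (InWindow i j)
inWindow? {r} i j =
  (toℕ j ≟ toℕ i) ⊎-dec (toℕ j ≟ suc (toℕ i)) ⊎-dec ((suc (toℕ i) ≟ r) ×-dec (toℕ j ≟ 0))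

MoveAt : (c : Config) → Fin (length c) → (Fin (length c) → ℕ) → Set
MoveAt c i d = (∀ j → d j ≤ lookup c j)
             × (∀ j → d j ≢ lookup c j → InWindow i j)
             × (Σ[ j ∈ Fin (length c) ] d j < lookup c j)

-- Transport along a relabelling σ of the piles; its right inverse locates the pile that strictly
-- shrinks.
MoveAt-map : ∀ {c e i i′ d} (σ : Fin (length e) → Fin (length c)) (σ⁻¹ : Fin (length c) → Fin (length e)) →
             (∀ j → σ (σ⁻¹ j) ≡ j) → (∀ j → lookup c (σ j) ≡ lookup e j) →
             (∀ j → InWindow i (σ j) → InWindow i′ j) → MoveAt c i d → MoveAt e i′ (d ∘ σ)
MoveAt-map {c} {e} {d = d} σ σ⁻¹ inv same window (le , win , j , lt) =
    (λ j → subst (d (σ j) ≤_) (same j) (le (σ j)))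
  , (λ j ne → window j (win (σ j) (λ eq → ne (trans eq (same j)))))
  , σ⁻¹ j , subst₂ _<_ (cong d (sym (inv j))) (trans (cong (lookup c) (sym (inv j))) (same (σ⁻¹ j))) lt

next prev : ∀ {n} → Fin (suc n) → Fin (suc n)
next i with view i
... | ‵fromℕ = zero
... | ‵inj₁ {i = i′} _ = suc i′
prev zero = fromℕ _
prev (suc i) = inject₁ i

next-prev : ∀ {n} (i : Fin (suc n)) → next (prev i) ≡ i
next-prev {n} zero rewrite view-fromℕ n = refl
next-prev (suc i) rewrite view-inject₁ i = refl

-- Decided by enumeration once r is known.
window-rot? : ∀ r → Dec (∀ (i j : Fin (suc r)) → InWindow i (next j) → InWindow (prev i) j)
window-rot? r = all? λ i → all? λ j → inWindow? i (next j) →-dec inWindow? (prev i) j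

-- Reflection reverses the order inside a window, so the image of the window at i starts at the
-- image of `next i`.
window-flip? : ∀ r → Dec (∀ (i j : Fin (suc r)) → InWindow i (opposite j) → InWindow (opposite (next i)) j)
window-flip? r = all? λ i → all? λ j → inWindow? i (opposite j) →-dec inWindow? (opposite (next i)) j

toMove : ∀ {c i d} → MoveAt c i d → Move c (removeZeros (tabulate d))
toMove {i = i} {d} (le , win , lt) = i , d , le , win , lt , refl

removeZeros-positive : ∀ c → Positive (removeZeros c)
removeZeros-positive [] = []
removeZeros-positive (zero ∷ c) = removeZeros-positive c
removeZeros-positive (suc x ∷ c) = s≤s z≤n ∷ removeZeros-positive c

removeZeros-id : ∀ {c} → Positive c → removeZeros c ≡ c
removeZeros-id [] = refl
removeZeros-id (s≤s z≤n ∷ ps) = cong (_ ∷_) (removeZeros-id ps)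

sum-removeZeros : ∀ c → sum (removeZeros c) ≡ sum c
sum-removeZeros [] = refl
sum-removeZeros (zero ∷ c) = sum-removeZeros c
sum-removeZeros (suc x ∷ c) = cong (suc x +_) (sum-removeZeros c)

length-removeZeros : ∀ c → length (removeZeros c) ≤ length c
length-removeZeros [] = z≤n
length-removeZeros (zero ∷ c) = m≤n⇒m≤1+n (length-removeZeros c)
length-removeZeros (suc x ∷ c) = s≤s (length-removeZeros c)

removeZeros-++ : ∀ c e → removeZeros (c ++ e) ≡ removeZeros c ++ removeZeros e
removeZeros-++ [] e = refl
removeZeros-++ (zero ∷ c) e = removeZeros-++ c e
removeZeros-++ (suc x ∷ c) e = cong (suc x ∷_) (removeZeros-++ c e)

removeZeros-reverse : ∀ c → removeZeros (reverse c) ≡ reverse (removeZeros c)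
removeZeros-reverse [] = refl
removeZeros-reverse (zero ∷ c)
  rewrite unfold-reverse zero c | removeZeros-++ (reverse c) (zero ∷ []) | ++-identityʳ (removeZeros (reverse c)) =
  removeZeros-reverse c
removeZeros-reverse (suc x ∷ c)
  rewrite unfold-reverse (suc x) c | removeZeros-++ (reverse c) (suc x ∷ [])
        | unfold-reverse (suc x) (removeZeros c) = cong (_++ suc x ∷ []) (removeZeros-reverse c)

-- If the first pile has vanished, the rotation is invisible after `removeZeros`; otherwise it
-- rotates the surviving piles.
Cold-removeZeros-rot1 : ∀ w → Cold (removeZeros w) → Cold (removeZeros (rot1 w))
Cold-removeZeros-rot1 [] p = p
Cold-removeZeros-rot1 (zero ∷ w) p =
  subst Cold (sym (trans (removeZeros-++ w (0 ∷ [])) (++-identityʳ _))) p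
Cold-removeZeros-rot1 (suc x ∷ w) p =
  subst Cold (sym (removeZeros-++ w (suc x ∷ []))) (Cold-rot1 (suc x ∷ removeZeros w) p)

Cold-removeZeros-reverse : ∀ w → Cold (removeZeros w) → Cold (removeZeros (reverse w))
Cold-removeZeros-reverse w p = subst Cold (sym (removeZeros-reverse w)) (Cold-reverse (removeZeros w) p)

-- Weaker than deciding `Cold`: a reply may be proposed without knowing beforehand whether the
-- circle is already cold.
data Result (c : Config) : Set where
  cold : Cold c → Result c
  winning : ∀ c′ → Move c c′ → Cold c′ → Result c

window-rot : ∀ r {_ : True (window-rot? r)} i j → InWindow i (next j) → InWindow (prev i) j
window-rot r {t} = toWitness t

lookup-next3 : ∀ {a b c : ℕ} j → lookup (a ∷ b ∷ c ∷ []) (next j) ≡ lookup (b ∷ c ∷ a ∷ []) j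
lookup-next3 0F = refl
lookup-next3 1F = refl
lookup-next3 2F = refl

-- At a concrete length `tabulate (d ∘ next)` computes to `rot1 (tabulate d)`; hence one version for
-- each number of piles.
Result-rot3 : ∀ {a b c} → Result (a ∷ b ∷ c ∷ []) → Result (b ∷ c ∷ a ∷ [])
Result-rot3 {a} {b} {c} (cold p) = cold (Cold-rot1 (a ∷ b ∷ c ∷ []) p)
Result-rot3 (winning _ (i , d , le , w , lt , refl) p) = winning _
  (toMove (MoveAt-map next prev next-prev lookup-next3 (window-rot 2 i) (le , w , lt)))
  (Cold-removeZeros-rot1 (tabulate d) p)

lookup-next4 : ∀ {a b c d : ℕ} j → lookup (a ∷ b ∷ c ∷ d ∷ []) (next j) ≡ lookup (b ∷ c ∷ d ∷ a ∷ []) j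
lookup-next4 0F = refl
lookup-next4 1F = refl
lookup-next4 2F = refl
lookup-next4 3F = refl

Result-rot4 : ∀ {a b c d} → Result (a ∷ b ∷ c ∷ d ∷ []) → Result (b ∷ c ∷ d ∷ a ∷ [])
Result-rot4 {a} {b} {c} {d} (cold p) = cold (Cold-rot1 (a ∷ b ∷ c ∷ d ∷ []) p)
Result-rot4 (winning _ (i , d , le , w , lt , refl) p) = winning _
  (toMove (MoveAt-map next prev next-prev lookup-next4 (window-rot 3 i) (le , w , lt)))
  (Cold-removeZeros-rot1 (tabulate d) p)

lookup-next5 : ∀ {a b c d e : ℕ} j → lookup (a ∷ b ∷ c ∷ d ∷ e ∷ []) (next j) ≡ lookup (b ∷ c ∷ d ∷ e ∷ a ∷ []) j
lookup-next5 0F = refl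
lookup-next5 1F = refl
lookup-next5 2F = refl
lookup-next5 3F = refl
lookup-next5 4F = refl

Result-rot5 : ∀ {a b c d e} → Result (a ∷ b ∷ c ∷ d ∷ e ∷ []) → Result (b ∷ c ∷ d ∷ e ∷ a ∷ [])
Result-rot5 {a} {b} {c} {d} {e} (cold p) = cold (Cold-rot1 (a ∷ b ∷ c ∷ d ∷ e ∷ []) p)
Result-rot5 (winning _ (i , d , le , w , lt , refl) p) = winning _
  (toMove (MoveAt-map next prev next-prev lookup-next5 (window-rot 4 i) (le , w , lt)))
  (Cold-removeZeros-rot1 (tabulate d) p)

lookup-opposite5 : ∀ {a b c d e : ℕ} j → lookup (a ∷ b ∷ c ∷ d ∷ e ∷ []) (opposite j) ≡ lookup (e ∷ d ∷ c ∷ b ∷ a ∷ []) j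
lookup-opposite5 0F = refl
lookup-opposite5 1F = refl
lookup-opposite5 2F = refl
lookup-opposite5 3F = refl
lookup-opposite5 4F = refl

Result-flip5 : ∀ {a b c d e} → Result (a ∷ b ∷ c ∷ d ∷ e ∷ []) → Result (e ∷ d ∷ c ∷ b ∷ a ∷ [])
Result-flip5 {a} {b} {c} {d} {e} (cold p) = cold (Cold-reverse (a ∷ b ∷ c ∷ d ∷ e ∷ []) p)
Result-flip5 (winning _ (i , d , le , w , lt , refl) p) = winning _
  (toMove (MoveAt-map opposite opposite opposite-involutive lookup-opposite5
    (toWitness {a? = window-flip? 4} _ i) (le , w , lt)))
  (Cold-removeZeros-reverse (tabulate d) p)

-- No move joins two cold positions

front : ∀ {x y q d} → MoveAt (x ∷ y ∷ q) 0F d →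
        d 0F ≤ x × d 1F ≤ y × d 0F + d 1F < x + y × tabulate d ≡ d 0F ∷ d 1F ∷ q
front {x} {y} {q} {d} (le , window , lt) =
  le 0F , le 1F , decrease lt , cong (λ e → d 0F ∷ d 1F ∷ e) (trans (tabulate-cong unchanged) (tabulate-lookup q))
  where
  unchanged : ∀ j → d (suc (suc j)) ≡ lookup q j
  unchanged j = decidable-stable (_ ≟ _) (λ ne → outside (window (suc (suc j)) ne))
    where
    outside : ¬ InWindow 0F (suc (suc j))
    outside (inj₁ ())
    outside (inj₂ (inj₁ ()))
    outside (inj₂ (inj₂ (() , _)))
  decrease : Σ[ j ∈ _ ] d j < lookup (x ∷ y ∷ q) j → d 0F + d 1F < x + y
  decrease (0F , lt) = +-mono-<-≤ lt (le 1F)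
  decrease (1F , lt) = +-mono-≤-< (le 0F) lt
  decrease (suc (suc j) , lt) = contradiction (unchanged j) (<⇒≢ lt)

-- The sum hypothesis encodes strictness as a single inequality; comparing the halves
-- rules out an even number equal to an odd one, which rational reasoning cannot see.
no-pair-move : ∀ h h′ x₀ x₁ x₂ x₃ x₄ y₀ y₁ → y₀ ≤ x₀ → y₁ ≤ x₁ → y₀ + y₁ < x₀ + x₁ →
               Pentagon h x₀ x₁ x₂ x₃ x₄ → Pentagon h′ y₀ y₁ x₂ x₃ x₄ → ⊥
no-pair-move h h′ x₀ x₁ x₂ x₃ x₄ y₀ y₁ le₀ le₁ lt p q = contradiction-by
  (var 7F ≼ var 2F & var 8F ≼ var 3F & var 7F ⊕ var 8F ≺ var 2F ⊕ var 3F
    & pentagon (var 0F) (var 2F) (var 3F) (var 4F) (var 5F) (var 6F)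
    & pentagon (var 1F) (var 7F) (var 8F) (var 4F) (var 5F) (var 6F))
  (var 0F ≼ var 1F or var 1F ≺ var 0F)
  (h ∷ h′ ∷ x₀ ∷ x₁ ∷ x₂ ∷ x₃ ∷ x₄ ∷ y₀ ∷ y₁ ∷ [])
  (le₀ , le₁ , lt , p , q) (≤-<-connex h h′)

-- Excludes emptying both selected piles, which would have to leave (a , a , a).
no-triple : ∀ h x₀ x₁ x₂ x₃ x₄ → Pentagon h x₀ x₁ x₂ x₃ x₄ → x₂ ≡ x₃ → x₃ ≡ x₄ → ⊥
no-triple h x₀ x₁ x₂ x₃ x₄ p e e′ = contradiction-by
  (var 3F ≈ var 4F & var 4F ≈ var 5F & pentagon (var 0F) (var 1F) (var 2F) (var 3F) (var 4F) (var 5F))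
  -- A trivially true filler: here no case split is required.
  (con 0 ≼ con 0)
  (h ∷ x₀ ∷ x₁ ∷ x₂ ∷ x₃ ∷ x₄ ∷ []) (e , e′ , p) z≤n

-- Excludes emptying exactly one selected pile: the survivor would equal its opposite pile x₃, so x₃
-- is at most the pile it was lowered from.
no-alternation : ∀ h x₀ x₁ x₂ x₃ x₄ → Pentagon h x₀ x₁ x₂ x₃ x₄ →
                 x₃ ≤ x₀ ⊎ x₃ ≤ x₁ → x₂ ≡ x₄ → x₂ ≢ x₃ → ⊥
no-alternation h x₀ x₁ x₂ x₃ x₄ p le e ne = contradiction-by
  (var 3F ≈ var 5F & (var 4F ≼ var 1F or var 4F ≼ var 2F)
    & pentagon (var 0F) (var 1F) (var 2F) (var 3F) (var 4F) (var 5F))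
  (var 3F ≺ var 4F or var 4F ≺ var 3F)
  (h ∷ x₀ ∷ x₁ ∷ x₂ ∷ x₃ ∷ x₄ ∷ []) (e , le , p) (≢⇒<⊎> ne)
  where
  ≢⇒<⊎> : ∀ {m n} → m ≢ n → m < n ⊎ n < m
  ≢⇒<⊎> {m} {n} ne with <-cmp m n
  ... | tri< a _ _ = inj₁ a
  ... | tri≈ _ b _ = contradiction b ne
  ... | tri> _ _ c = inj₂ c

-- The cases record which selected piles vanish. Matching the positivity of the tail as `s≤s z≤n`
-- exposes successors, so that `removeZeros` computes.
cold-front : ∀ x y q w₀ w₁ → Positive (x ∷ y ∷ q) → w₀ ≤ x → w₁ ≤ y → w₀ + w₁ < x + y →
             Cold (x ∷ y ∷ q) → Cold (removeZeros (w₀ ∷ w₁ ∷ q)) → ⊥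
cold-front x y (z ∷ []) (suc w₀) (suc w₁) (_ ∷ _ ∷ s≤s z≤n ∷ []) _ _ lt (refl , refl) (refl , refl) = <-irrefl refl lt
cold-front x y (z ∷ []) zero zero (_ ∷ _ ∷ s≤s z≤n ∷ []) _ _ lt (refl , refl) ()
cold-front x y (z ∷ []) zero (suc w₁) (_ ∷ _ ∷ s≤s z≤n ∷ []) _ _ lt (refl , refl) ()
cold-front x y (z ∷ []) (suc w₀) zero (_ ∷ _ ∷ s≤s z≤n ∷ []) _ _ lt (refl , refl) ()
cold-front x y (_ ∷ _ ∷ []) zero zero (_ ∷ _ ∷ s≤s z≤n ∷ s≤s z≤n ∷ []) _ _ lt (refl , refl , x≢y) ()
cold-front x y (_ ∷ _ ∷ []) zero (suc w₁) (_ ∷ _ ∷ s≤s z≤n ∷ s≤s z≤n ∷ []) _ _ lt (refl , refl , x≢y) (_ , e) = x≢y e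
cold-front x y (_ ∷ _ ∷ []) (suc w₀) zero (_ ∷ _ ∷ s≤s z≤n ∷ s≤s z≤n ∷ []) _ _ lt (refl , refl , x≢y) (_ , e) = x≢y e
cold-front x y (_ ∷ _ ∷ []) (suc w₀) (suc w₁) (_ ∷ _ ∷ s≤s z≤n ∷ s≤s z≤n ∷ []) _ _ lt (refl , refl , x≢y) (refl , refl , _) =
  <-irrefl refl lt
cold-front x y (z ∷ s ∷ t ∷ []) zero zero (_ ∷ _ ∷ s≤s z≤n ∷ s≤s z≤n ∷ s≤s z≤n ∷ []) _ _ _ (h , p) (e , e′) =
  no-triple h x y z s t p e e′
cold-front x y (z ∷ s ∷ t ∷ []) zero (suc w₁) (_ ∷ _ ∷ s≤s z≤n ∷ s≤s z≤n ∷ s≤s z≤n ∷ []) _ le _ (h , p) (refl , e , ne) =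
  no-alternation h x y z s t p (inj₂ le) e (ne ∘ sym)
cold-front x y (z ∷ s ∷ t ∷ []) (suc w₀) zero (_ ∷ _ ∷ s≤s z≤n ∷ s≤s z≤n ∷ s≤s z≤n ∷ []) le _ _ (h , p) (refl , e , ne) =
  no-alternation h x y z s t p (inj₁ le) e (ne ∘ sym)
cold-front x y (z ∷ s ∷ t ∷ []) (suc w₀) (suc w₁) (_ ∷ _ ∷ s≤s z≤n ∷ s≤s z≤n ∷ s≤s z≤n ∷ []) le₀ le₁ lt (h , p) (h′ , p′) =
  no-pair-move h h′ x y z s t (suc w₀) (suc w₁) le₀ le₁ lt p p′

cold-front-move : ∀ x y q → Positive (x ∷ y ∷ q) → Cold (x ∷ y ∷ q) →
                  ∀ d → MoveAt (x ∷ y ∷ q) 0F d → Cold (removeZeros (tabulate d)) → ⊥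
cold-front-move x y q ps p d m p′ with front m
... | le₀ , le₁ , lt , e = cold-front x y q _ _ ps le₀ le₁ lt p (subst (Cold ∘ removeZeros) e p′)

Positive-rot1 : ∀ {c} → Positive c → Positive (rot1 c)
Positive-rot1 [] = []
Positive-rot1 (p ∷ ps) = ++⁺ ps (p ∷ [])

-- Induction on the start of the window: one rotation turns `suc i` into `inject₁ i`. The piles are
-- quantified after i because the rotation permutes them.
escape3 : ∀ (i : Fin 3) a b c → Positive (a ∷ b ∷ c ∷ []) → Cold (a ∷ b ∷ c ∷ []) →
          ∀ f → MoveAt (a ∷ b ∷ c ∷ []) i f → Cold (removeZeros (tabulate f)) → ⊥
escape3 = <-weakInduction _
  (λ a b c → cold-front-move a b (c ∷ []))
  (λ i escape a b c ps p f m p′ → escape b c a (Positive-rot1 ps) (Cold-rot1 (a ∷ b ∷ c ∷ []) p) (f ∘ next)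
    (MoveAt-map next prev next-prev lookup-next3 (window-rot 2 (suc i)) m)
    (Cold-removeZeros-rot1 (tabulate f) p′))

escape4 : ∀ (i : Fin 4) a b c d → Positive (a ∷ b ∷ c ∷ d ∷ []) → Cold (a ∷ b ∷ c ∷ d ∷ []) →
          ∀ f → MoveAt (a ∷ b ∷ c ∷ d ∷ []) i f → Cold (removeZeros (tabulate f)) → ⊥
escape4 = <-weakInduction _
  (λ a b c d → cold-front-move a b (c ∷ d ∷ []))
  (λ i escape a b c d ps p f m p′ → escape b c d a (Positive-rot1 ps) (Cold-rot1 (a ∷ b ∷ c ∷ d ∷ []) p) (f ∘ next)
    (MoveAt-map next prev next-prev lookup-next4 (window-rot 3 (suc i)) m)
    (Cold-removeZeros-rot1 (tabulate f) p′))

escape5 : ∀ (i : Fin 5) a b c d e → Positive (a ∷ b ∷ c ∷ d ∷ e ∷ []) → Cold (a ∷ b ∷ c ∷ d ∷ e ∷ []) →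
          ∀ f → MoveAt (a ∷ b ∷ c ∷ d ∷ e ∷ []) i f → Cold (removeZeros (tabulate f)) → ⊥
escape5 = <-weakInduction _
  (λ a b c d e → cold-front-move a b (c ∷ d ∷ e ∷ []))
  (λ i escape a b c d e ps p f m p′ → escape b c d e a (Positive-rot1 ps) (Cold-rot1 (a ∷ b ∷ c ∷ d ∷ e ∷ []) p) (f ∘ next)
    (MoveAt-map next prev next-prev lookup-next5 (window-rot 4 (suc i)) m)
    (Cold-removeZeros-rot1 (tabulate f) p′))

no-escape : ∀ c → Positive c → Cold c → ∀ c′ → Move c c′ → Cold c′ → ⊥
no-escape (a ∷ b ∷ c ∷ []) ps p _ (i , f , le , w , lt , refl) =
  escape3 i a b c ps p f (le , w , lt)
no-escape (a ∷ b ∷ c ∷ d ∷ []) ps p _ (i , f , le , w , lt , refl) =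
  escape4 i a b c d ps p f (le , w , lt)
no-escape (a ∷ b ∷ c ∷ d ∷ e ∷ []) ps p _ (i , f , le , w , lt , refl) =
  escape5 i a b c d e ps p f (le , w , lt)

-- Replies reaching a cold position

lower : ∀ {x y q c} w₀ w₁ → w₀ ≤ x → w₁ ≤ y → w₀ < x ⊎ w₁ < y →
        removeZeros (w₀ ∷ w₁ ∷ q) ≡ c → Cold c → Result (x ∷ y ∷ q)
lower {x} {y} {q} {c} w₀ w₁ le₀ le₁ lt e p =
  winning c (0F , lookup (w₀ ∷ w₁ ∷ q) , le , window , strict lt
    , trans (sym e) (cong removeZeros (sym (tabulate-lookup (w₀ ∷ w₁ ∷ q))))) p
  where
  le : ∀ j → lookup (w₀ ∷ w₁ ∷ q) j ≤ lookup (x ∷ y ∷ q) j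
  le 0F = le₀
  le 1F = le₁
  le (suc (suc j)) = ≤-refl
  window : ∀ j → lookup (w₀ ∷ w₁ ∷ q) j ≢ lookup (x ∷ y ∷ q) j → InWindow 0F j
  window 0F _ = inj₁ refl
  window 1F _ = inj₂ (inj₁ refl)
  window (suc (suc j)) ne = contradiction refl ne
  strict : w₀ < x ⊎ w₁ < y → Σ[ j ∈ Fin (length (x ∷ y ∷ q)) ] lookup (w₀ ∷ w₁ ∷ q) j < lookup (x ∷ y ∷ q) j
  strict (inj₁ l) = 0F , l
  strict (inj₂ l) = 1F , l

-- If neither pile has to shrink there is no move, but then the circle is itself the cold target.
settle : ∀ {x y q} w₀ w₁ → Positive (w₀ ∷ w₁ ∷ q) → w₀ ≤ x → w₁ ≤ y → Cold (w₀ ∷ w₁ ∷ q) → Result (x ∷ y ∷ q)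
settle w₀ w₁ ps le₀ le₁ p with m≤n⇒m<n∨m≡n le₀ | m≤n⇒m<n∨m≡n le₁
... | inj₁ l | _ = lower w₀ w₁ le₀ le₁ (inj₁ l) (removeZeros-id ps) p
... | inj₂ _ | inj₁ l = lower w₀ w₁ le₀ le₁ (inj₂ l) (removeZeros-id ps) p
... | inj₂ refl | inj₂ refl = cold p

delete-first : ∀ {x y q} w → Positive (w ∷ q) → 1 ≤ x → w ≤ y → Cold (w ∷ q) → Result (x ∷ y ∷ q)
delete-first w ps px le = lower 0 w z≤n le (inj₁ px) (removeZeros-id ps)

delete-second : ∀ {x y q} w → Positive (w ∷ q) → w ≤ x → 1 ≤ y → Cold (w ∷ q) → Result (x ∷ y ∷ q)
delete-second w (s≤s z≤n ∷ ps) le py = lower w 0 le z≤n (inj₂ py) (cong (w ∷_) (removeZeros-id ps))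

delete-both : ∀ {x y q} → Positive q → 1 ≤ x → Cold q → Result (x ∷ y ∷ q)
delete-both ps px = lower 0 0 z≤n z≤n (inj₁ px) (removeZeros-id ps)

triangle : ∀ {a b c} → 1 ≤ c → c ≤ a → c ≤ b → Result (a ∷ b ∷ c ∷ [])
triangle {c = c} pc ca cb = settle c c (pc ∷ pc ∷ pc ∷ []) ca cb (refl , refl)

-- Levelling opposite piles gives (c , d , c , d). For c = d this is not cold, but deleting one pile
-- as well leaves (c , c , c).
square : ∀ {a b c d} → 1 ≤ c → 1 ≤ d → c ≤ a → d ≤ b → Result (a ∷ b ∷ c ∷ d ∷ [])
square {c = c} {d} pc pd ca db with c ≟ d
... | no c≢d = settle c d (pc ∷ pd ∷ pc ∷ pd ∷ []) ca db (refl , refl , c≢d)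
... | yes refl = delete-first c (pc ∷ pc ∷ pc ∷ []) (≤-trans pc ca) db (refl , refl)

-- The two replies of family (4) that keep m.
aim : ∀ {x m a b y} → 1 ≤ m → m ≤ y → m < a → m < b → Result (x ∷ m ∷ a ∷ b ∷ y ∷ []) ⊎ x ≤ a
aim {x} {m} {a} {b} {y} pm my ma mb with <-≤-connex (x + m) (a + b) | ≤-<-connex x a
... | _ | inj₁ xa = inj₂ xa
-- M is a + b ∸ m, above a and b because m is below both. The window is (y , x), and y drops to m.
... | inj₂ ge | inj₂ ax with m≤n⇒∃[o]m+o≡n (≤-trans (<⇒≤ mb) (m≤n+m b a))
...   | M , e = inj₁ (Result-rot5 (settle m M
  (pm ∷ ≤-trans pm (<⇒≤ (<-trans ma a<M)) ∷ pm ∷ ≤-trans pm (<⇒≤ ma) ∷ ≤-trans pm (<⇒≤ mb) ∷ []) my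
  (+-cancelˡ-≤ m M x (subst₂ _≤_ (sym e) (+-comm x m) ge))
  (0 , inj₂ (inj₁ (inj₁ (refl , trans (+-comm M m) e , ma , a<M , mb , b<M))))))
  where
  a<M : a < M
  a<M = +-cancelˡ-< m a M (subst₂ _<_ (+-comm a m) (sym e) (+-monoʳ-< a mb))
  b<M : b < M
  b<M = +-cancelˡ-< m b M (subst (m + b <_) (sym e) (+-monoˡ-< b ma))
-- Now x stays as the largest pile and b drops to b′ = x + m ∸ a, strictly between m and x because m
-- < a < x.
aim {x} {m} {a} {b} {y} pm my ma mb | inj₁ lt | inj₂ ax with m≤n⇒∃[o]m+o≡n (≤-trans (<⇒≤ ax) (m≤m+n x m))
... | b′ , e = inj₁ (Result-rot5 (Result-rot5 (settle b′ m
  (≤-trans pm (<⇒≤ m<b′) ∷ pm ∷ ≤-trans pm (<⇒≤ (<-trans ma ax)) ∷ pm ∷ ≤-trans pm (<⇒≤ ma) ∷ [])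
  (<⇒≤ (+-cancelˡ-< a b′ b (subst (_< a + b) (sym e) lt))) my
  (0 , inj₂ (inj₂ (inj₁ (inj₁ (refl , sym e , ma , ax , m<b′ , b′<x))))))))
  where
  m<b′ : m < b′
  m<b′ = +-cancelˡ-< a m b′ (subst (a + m <_) (sym e) (+-monoˡ-< m ax))
  b′<x : b′ < x
  b′<x = +-cancelˡ-< a b′ x (subst₂ _<_ (sym e) (+-comm x a) (+-monoʳ-< x ma))

-- The main target is (p , m + 1 , p , m , m), as in `f5` or `f6`; it requires p ≥ m + 2 for even m
-- and p ≥ m + 3 for odd m. Smaller p is treated separately.
doubled-minimum-≤ : ∀ {q t p m} → 1 ≤ m → m ≤ t → m ≤ p → p ≤ q → Result (q ∷ t ∷ p ∷ m ∷ m ∷ [])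
doubled-minimum-≤ {q} {t} {p} {m} pm mt mp pq with m≤n⇒m<n∨m≡n mp | m≤n⇒m<n∨m≡n mt | halve m
... | inj₂ refl | _ | _ = delete-both (pm ∷ pm ∷ pm ∷ []) (≤-trans pm pq) (refl , refl)
... | inj₁ m<p | inj₂ refl | _ =
  Result-rot5 (delete-first p (pp ∷ pm ∷ pp ∷ pm ∷ []) pm pq (refl , refl , <⇒≢ m<p ∘ sym))
  where pp = ≤-trans pm mp
... | inj₁ m<p | inj₁ m<t | h , inj₁ e with m≤n⇒m<n∨m≡n m<p
...   | inj₁ 2+m≤p = settle p (suc m) (pp ∷ s≤s z≤n ∷ pp ∷ pm ∷ pm ∷ []) pq m<t
        (h , inj₂ (inj₁ (inj₂ (inj₁ (refl , refl , refl , inj₁ (e , 2+m≤p))))))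
  where pp = ≤-trans pm mp
-- For even m and p = m + 1, the odd number n = m ∸ 1 becomes the new repeated minimum: (n , n , n +
-- 2 , n + 1 , n + 1) is a rotation of `f8`.
doubled-minimum-≤ {q} {t} {p} {m} pm mt mp pq | inj₁ m<p | inj₁ m<t | suc h , inj₁ refl | inj₂ refl =
  settle n n (pn ∷ pn ∷ s≤s z≤n ∷ s≤s z≤n ∷ s≤s z≤n ∷ [])
    (≤-trans (n≤1+n n) (≤-trans (n≤1+n m) pq)) (≤-trans (n≤1+n n) mt)
    (h , inj₂ (inj₂ (inj₂ (inj₁ (inj₂ (inj₂ (refl , +-suc h h , inj₂ (inj₁ (refl , refl , refl)))))))))
  where
  n = h + suc h
  pn : 1 ≤ n
  pn = ≤-trans (s≤s z≤n) (m≤n+m (suc h) h)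
doubled-minimum-≤ {m = m} pm mt mp pq | inj₁ m<p | inj₁ m<t | h , inj₂ e with m≤n⇒m<n∨m≡n m<p
... | inj₁ 2+m≤p with m≤n⇒m<n∨m≡n 2+m≤p
...   | inj₁ 3+m≤p = settle _ (suc m) (≤-trans pm mp ∷ s≤s z≤n ∷ ≤-trans pm mp ∷ pm ∷ pm ∷ []) pq m<t
        (h , inj₂ (inj₁ (inj₂ (inj₁ (refl , refl , refl , inj₂ (e , 3+m≤p))))))
...   | inj₂ refl = settle (suc m) (suc m) (s≤s z≤n ∷ s≤s z≤n ∷ s≤s z≤n ∷ pm ∷ pm ∷ []) (≤-trans m<p pq) m<t
        (h , inj₂ (inj₁ (inj₂ (inj₂ (refl , e , inj₂ (inj₂ (refl , refl , refl)))))))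
-- For odd m and p = m + 1, a spare stone on t leads to `f7` and one on q to `f8`; if q = t = p,
-- deleting both copies of m leaves three equal piles.
doubled-minimum-≤ {m = m} pm mt mp pq | inj₁ m<p | inj₁ m<t | h , inj₂ e | inj₂ refl
  with m≤n⇒m<n∨m≡n m<t | m≤n⇒m<n∨m≡n pq
... | inj₁ 2+m≤t | _ = settle (1 + m) (2 + m) (s≤s z≤n ∷ s≤s z≤n ∷ s≤s z≤n ∷ pm ∷ pm ∷ []) pq 2+m≤t
        (h , inj₂ (inj₁ (inj₂ (inj₂ (refl , e , inj₁ (refl , refl , refl))))))
... | inj₂ refl | inj₁ 2+m≤q = settle (2 + m) (1 + m) (s≤s z≤n ∷ s≤s z≤n ∷ s≤s z≤n ∷ pm ∷ pm ∷ []) 2+m≤q ≤-refl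
        (h , inj₂ (inj₁ (inj₂ (inj₂ (refl , e , inj₂ (inj₁ (refl , refl , refl)))))))
... | inj₂ refl | inj₂ refl =
  Result-rot5 (Result-rot5 (delete-both (s≤s z≤n ∷ s≤s z≤n ∷ s≤s z≤n ∷ []) pm (refl , refl)))

-- Reflection exchanges p and q and fixes t, which reduces to p ≤ q.
doubled-minimum : ∀ {q t p m} → 1 ≤ m → m ≤ q → m ≤ t → m ≤ p → Result (q ∷ t ∷ p ∷ m ∷ m ∷ [])
doubled-minimum {q} {p = p} pm mq mt mp with ≤-total p q
... | inj₁ pq = doubled-minimum-≤ pm mt mp pq
... | inj₂ qp = Result-rot5 (Result-rot5 (Result-flip5 (doubled-minimum-≤ pm mt mq qp)))

isolated-minimum : ∀ {x m a b y} → 1 ≤ m → m ≤ x → m < a → m < b → m ≤ y → Result (x ∷ m ∷ a ∷ b ∷ y ∷ [])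
isolated-minimum {x} {m} {a} {b} {y} pm mx ma mb my with aim {x} pm my ma mb
... | inj₁ r = r
... | inj₂ xa with m≤n⇒m<n∨m≡n mx | m≤n⇒m<n∨m≡n my
...   | inj₂ refl | _ = Result-rot5 (Result-rot5 (Result-rot5 (doubled-minimum pm (<⇒≤ ma) (<⇒≤ mb) my)))
...   | inj₁ m<x | inj₂ refl = Result-rot5 (Result-rot5 (Result-rot5
  (delete-second x (px ∷ pm ∷ px ∷ pm ∷ []) xa (≤-trans pm (<⇒≤ mb)) (refl , refl , <⇒≢ m<x ∘ sym))))
  where px = ≤-trans pm mx
-- Read in the opposite direction the circle is (a , m , x , y , b), so `aim` applies with x and a,
-- and b and y, exchanged.
...   | inj₁ m<x | inj₁ m<y with aim {a} pm (<⇒≤ mb) m<x m<y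
...     | inj₁ r = Result-rot5 (Result-rot5 (Result-flip5 r))
...     | inj₂ ax with ≤-antisym xa ax
...       | refl = Result-rot5 (Result-rot5
  (delete-second m (pm ∷ px ∷ pm ∷ px ∷ []) (<⇒≤ mb) (≤-trans pm my) (refl , refl , <⇒≢ m<x)))
  where px = ≤-trans pm mx

minimum-second : ∀ {x m a b y} → 1 ≤ m → m ≤ x → m ≤ a → m ≤ b → m ≤ y → Result (x ∷ m ∷ a ∷ b ∷ y ∷ [])
minimum-second pm mx ma mb my
  with m≤n⇒m<n∨m≡n mx | m≤n⇒m<n∨m≡n ma | m≤n⇒m<n∨m≡n mb | m≤n⇒m<n∨m≡n my
... | inj₂ refl | _ | _ | _ = Result-rot5 (Result-rot5 (Result-rot5 (doubled-minimum pm ma mb my)))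
... | inj₁ _ | inj₂ refl | _ | _ = Result-rot5 (Result-rot5 (doubled-minimum pm mb my mx))
... | inj₁ _ | inj₁ m<a | inj₁ m<b | _ = isolated-minimum pm mx m<a m<b my
... | inj₁ _ | inj₁ _ | inj₂ refl | inj₂ refl = doubled-minimum pm mx ≤-refl ma
-- The minimum occurs on two nonadjacent piles; seen from the other copy, the piles that must exceed
-- m are y and x.
... | inj₁ m<x | inj₁ _ | inj₂ refl | inj₁ m<y =
  Result-rot5 (Result-rot5 (Result-rot5 (isolated-minimum pm ma m<y m<x ≤-refl)))

minimum : ∀ {n} (f : Fin (suc n) → ℕ) → Σ[ i ∈ Fin (suc n) ] (∀ j → f i ≤ f j)
minimum {zero} f = 0F , λ { 0F → ≤-refl }
minimum {suc n} f with minimum (f ∘ suc)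
... | i , least with ≤-total (f 0F) (f (suc i))
...   | inj₁ le = 0F , λ { 0F → ≤-refl ; (suc j) → ≤-trans le (least j) }
...   | inj₂ ge = suc i , λ { 0F → ge ; (suc j) → least j }

result : ∀ c → Positive c → length c ≤ 5 → Result c
result [] _ _ = cold _
result (x ∷ []) (p ∷ []) _ =
  winning [] (0F , (λ _ → 0) , (λ _ → z≤n) , (λ { 0F _ → inj₁ refl }) , (0F , p) , refl) _
result (x ∷ y ∷ []) (p ∷ _) _ = delete-both [] p _
result (a ∷ b ∷ c ∷ []) (pa ∷ pb ∷ pc ∷ []) _ with minimum (lookup (a ∷ b ∷ c ∷ []))
... | 0F , least = Result-rot3 (Result-rot3 (triangle pa (least 1F) (least 2F)))
... | 1F , least = Result-rot3 (triangle pb (least 2F) (least 0F))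
... | 2F , least = triangle pc (least 0F) (least 1F)
result (a ∷ b ∷ c ∷ d ∷ []) (pa ∷ pb ∷ pc ∷ pd ∷ []) _ with ≤-total a c | ≤-total b d
... | inj₁ ac | inj₁ bd = Result-rot4 (Result-rot4 (square pa pb ac bd))
... | inj₁ ac | inj₂ db = Result-rot4 (Result-rot4 (Result-rot4 (square pd pa db ac)))
... | inj₂ ca | inj₁ bd = Result-rot4 (square pb pc bd ca)
... | inj₂ ca | inj₂ db = square pc pd ca db
result (a ∷ b ∷ c ∷ d ∷ e ∷ []) (pa ∷ pb ∷ pc ∷ pd ∷ pe ∷ []) _ with minimum (lookup (a ∷ b ∷ c ∷ d ∷ e ∷ []))
... | 0F , least = Result-rot5 (minimum-second pa (least 4F) (least 1F) (least 2F) (least 3F))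
... | 1F , least = minimum-second pb (least 0F) (least 2F) (least 3F) (least 4F)
... | 2F , least = Result-rot5 (Result-rot5 (Result-rot5 (Result-rot5
  (minimum-second pc (least 1F) (least 3F) (least 4F) (least 0F)))))
... | 3F , least = Result-rot5 (Result-rot5 (Result-rot5 (minimum-second pd (least 2F) (least 4F) (least 0F) (least 1F))))
... | 4F , least = Result-rot5 (Result-rot5 (minimum-second pe (least 3F) (least 0F) (least 1F) (least 2F)))
result (_ ∷ _ ∷ _ ∷ _ ∷ _ ∷ _ ∷ _) _ (s≤s (s≤s (s≤s (s≤s (s≤s ())))))

-- Termination and outcomes

sum-tabulate-≤ : ∀ c (d : Fin (length c) → ℕ) → (∀ j → d j ≤ lookup c j) → sum (tabulate d) ≤ sum c
sum-tabulate-≤ [] d le = z≤n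
sum-tabulate-≤ (x ∷ c) d le = +-mono-≤ (le 0F) (sum-tabulate-≤ c (d ∘ suc) (le ∘ suc))

sum-tabulate-< : ∀ c (d : Fin (length c) → ℕ) → (∀ j → d j ≤ lookup c j) → ∀ j → d j < lookup c j → sum (tabulate d) < sum c
sum-tabulate-< (x ∷ c) d le 0F lt = +-mono-<-≤ lt (sum-tabulate-≤ c (d ∘ suc) (le ∘ suc))
sum-tabulate-< (x ∷ c) d le (suc j) lt = +-mono-≤-< (le 0F) (sum-tabulate-< c (d ∘ suc) (le ∘ suc) j lt)

Move-sum : ∀ c {c′} → Move c c′ → sum c′ < sum c
Move-sum c (i , d , le , _ , (j , lt) , refl) =
  subst (_< sum c) (sym (sum-removeZeros (tabulate d))) (sum-tabulate-< c d le j lt)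

Move-length : ∀ c {c′} → Move c c′ → length c′ ≤ length c
Move-length c (i , d , _ , _ , _ , refl) =
  ≤-trans (length-removeZeros (tabulate d)) (≤-reflexive (length-tabulate d))

Move-positive : ∀ c {c′} → Move c c′ → Positive c′
Move-positive c (i , d , _ , _ , _ , refl) = removeZeros-positive (tabulate d)

-- Induction on the number of stones, with both claims together: successors of a cold position are
-- not cold, hence N by the second claim, while a cold successor is P by the first.
outcome : ∀ c → Acc _<_ (sum c) → Positive c → length c ≤ 5 → (Cold c → IsP c) × (Cold c ⊎ IsN c)
outcome c (acc rs) ps len = cold⇒P , cold⊎N (result c ps len)
  where
  after : ∀ {c′} → Move c c′ → (Cold c′ → IsP c′) × (Cold c′ ⊎ IsN c′)
  after m = outcome _ (rs (Move-sum c m)) (Move-positive c m) (≤-trans (Move-length c m) len)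
  cold⇒P : Cold c → IsP c
  cold⇒P p = isP λ c′ m → [ ⊥-elim ∘ no-escape c ps p c′ m , id ]′ (proj₂ (after m))
  cold⊎N : Result c → Cold c ⊎ IsN c
  cold⊎N (cold p) = inj₁ p
  cold⊎N (winning c′ m p) = inj₂ (isN c′ m (proj₁ (after m) p))

-- The winning move of the N-derivation, fed to the P-derivation, gives the same conflict at c′ with
-- smaller derivations.
P-N-exclusive : ∀ {c} → IsP c → IsN c → ⊥
P-N-exclusive (isP f) (isN c′ m p) = P-N-exclusive p (f c′ m)

theorem3p2 : (c : List ℕ) → All (λ x → 1 ≤ x) c → length c ≤ 5 →
    (IsP c ⇔ (Σ[ c₀ ∈ List ℕ ] (Listed c₀ × SameConfig c₀ c)))
theorem3p2 c ps len = mk⇔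
  (λ p → Cold⇒Good ps ([ id , ⊥-elim ∘ P-N-exclusive p ]′ (proj₂ decided)))
  (λ g → proj₁ decided (Good⇒Cold g))
  where decided = outcome c (<-wellFounded (sum c)) ps len
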